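{- Let $k\geq 4$ be an integer and let $\mathbf{x}=\mathbf{x}_k$ be the binary sequence defined in the context. Then the critical exponent of $\mathbf{x}$ equals $k+1$, and it is attained by the factors $0^{k+1}$ and $1^{k+1}$ of $\mathbf{x}$. Moreover, for no integer $n\geq 1$ does $\mathbf{x}$ contain a factor of length $2n+k$ having period $n$; consequently the asymptotic critical exponent of $\mathbf{x}$ equals $2$.
   Context: Fix an integer $k\geq 4$. Let $\mathcal{A}=\{0,1,\ldots,k-1,0',1',\ldots,(k-1)'\}$. Let $\xi=\xi_k:\mathcal{A}^*\to\mathcal{A}^*$ be the morphism given by $\xi(0)=01$, $\xi(j)=j+1$ for $1\leq j\leq k-2$, $\xi(k-1)=0'$, and $\xi(0')=0'1'$, $\xi(j')=(j+1)'$ for $1\leq j\leq k-2$, $\xi((k-1)')=0$. Let $\mathbf{u}=\xi^\omega(0)$ be the infinite fixed point of $\xi$ starting with $0$. Let $\pi:\mathcal{A}^*\to\{0,1\}^*$ be the letter-to-letter morphism with $\pi(0)=0$, $\pi(j')=0$ for $1\leq j\leq k-1$, $\pi(0')=1$, $\pi(j)=1$ for $1\leq j\leq k-1$. Put $\mathbf{x}=\pi(\mathbf{u})$. A word $z$ of length $p$ has period $q\geq 1$ if $z$ is a prefix of $u^\omega$ for some word $u$ of length $q$; then we write $z=u^{p/q}$. The critical exponent of an infinite word $\mathbf{v}$ is $E(\mathbf{v})=\sup\{r\in\mathbb{Q}: u^r \text{ is a non-empty factor of }\mathbf{v}\}$, and (when finite) the asymptotic critical exponent is $E^*(\mathbf{v})=\lim_{n\to\infty}\sup\{r\in\mathbb{Q}: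 u^r\text{ is a non-empty factor of }\mathbf{v}\text{ with }|u|\geq n\}$. -}

module Defs where

open import Data.Nat using (ℕ; zero; suc; _+_; _*_; _<_; _≤_; _<?_)
open import Data.Bool using (Bool; true; false; not)
open import Data.Product using (_×_; _,_; Σ; ∃)
open import Data.List using (List; []; _∷_; concatMap)
open import Relation.Nullary using (yes; no)
open import Relation.Binary.PropositionalEquality using (_≡_)

-- Letters of 𝒜 = {0,…,k-1,0',…,(k-1)'}: (j , false) is the letter j,
-- (j , true) is the primed letter j'.  Only j < k is ever used.
Letter : Set
Letter = ℕ × Bool

ξ : ℕ → Letter → List Letter
ξ k (zero , b) = (0 , b) ∷ (1 , b) ∷ []
ξ k (suc j , b) with suc (suc j) <? k
... | yes _ = (suc (suc j) , b) ∷ []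
... | no  _ = (0 , not b) ∷ []

ξ* : ℕ → List Letter → List Letter
ξ* k = concatMap (ξ k)

iter : ℕ → ℕ → List Letter
iter k zero    = (0 , false) ∷ []
iter k (suc m) = ξ* k (iter k m)

at : {A : Set} → A → List A → ℕ → A
at d []       _       = d
at d (a ∷ as) zero    = a
at d (a ∷ as) (suc i) = at d as i

-- u = ξ^ω(0): its i-th letter is the i-th letter of ξ^(i+1)(0)
-- (each ξ^m(0) is a prefix of ξ^(m+1)(0) and has length ≥ m+1,
--  so the default is never used).
u : ℕ → ℕ → Letter
u k i = at (0 , false) (iter k (suc i)) i

π : Letter → ℕ
π (zero  , false) = 0
π (suc _ , false) = 1
π (zero  , true)  = 1
π (suc _ , true)  = 0

x : ℕ → ℕ → ℕ
x k i = π (u k i)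

-- The factor of w of length p starting at position i has period q (q ≥ 1),
-- i.e. it is u^(p/q) for the word u of its first q letters.
PeriodicFactor : (ℕ → ℕ) → (i p q : ℕ) → Set
PeriodicFactor w i p q = 1 ≤ q × (∀ t → t + q < p → w (i + t) ≡ w (i + t + q))

HasConstFactor : (ℕ → ℕ) → ℕ → ℕ → Set
HasConstFactor w c n = ∃ λ i → ∀ t → t < n → w (i + t) ≡ c

CriticalExponentIsAttained : (ℕ → ℕ) → ℕ → Set
CriticalExponentIsAttained w r =
  (∀ i p q → 1 ≤ p → PeriodicFactor w i p q → p ≤ r * q)
  × (∃ λ i → ∃ λ p → ∃ λ q → 1 ≤ p × PeriodicFactor w i p q × p ≡ r * q)

-- E*(w) = r (r a natural number): with s_n = sup{ p/q : u^(p/q) non-empty factor, q ≥ n },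
-- lim s_n = r, written out: for every ε = 1/m there is N such that for all n ≥ N,
-- s_n ≤ r + 1/m and s_n > r - 1/m.
AsymptoticCriticalExponentIs : (ℕ → ℕ) → ℕ → Set
AsymptoticCriticalExponentIs w r =
  ∀ m → 1 ≤ m → ∃ λ N → ∀ n → N ≤ n →
    (∀ i p q → 1 ≤ p → n ≤ q → PeriodicFactor w i p q → m * p ≤ (r * m + 1) * q)
    × (∃ λ i → ∃ λ p → ∃ λ q → 1 ≤ p × n ≤ q × PeriodicFactor w i p q
         × (r * m) * q < m * p + q)

{-# OPTIONS --safe #-}
-- Call j and j' letters of opposite sign.  A square w w in u starts with a letter 0 of some sign s,
-- and the next letter is 0 of sign ¬ s or a nonzero letter of sign s; in particular u has no overlap.
-- Indeed a square starting with a nonzero letter can be shifted to the left, since nonzero letters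
-- determine their predecessors, and a square starting with 0 is the image under ξ of a shorter one.
-- The last point may fail at the right end only, because 0 and (k-1)' have images with the same first
-- letter; this leaves an almost square w a w b with {a, b} = {j, 0'} up to sign, j ≥ 1, and these are
-- excluded by the same induction.
--
-- Let now x have period n on a factor of length 2n + k, so that two windows of length n + k agree in x.
-- Reading them from left to right, the letters of u agree after at most k - 1 steps.  If they stay equal
-- for n steps, they form a square of u, whose next letter has the wrong image under π.  Otherwise the
-- first difference is again {j, 0'} up to sign: it either completes an almost square or
-- forces a difference in x two steps later.
module Submission where

open import Defs
open import Data.Nat using (ℕ; zero; suc; _+_; _*_; _∸_; _≤_; _<_; _<?_; _≤?_; z≤n; s≤s; z<s; s≤s⁻¹)
open import Data.Nat.Properties
open import Data.Nat.Tactic.RingSolver using (solve-∀)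
open import Data.Bool using (Bool; true; false; not)
open import Data.Bool.Properties using (not-involutive; not-injective; not-¬)
open import Data.List using (List; []; _∷_; _++_; length)
open import Data.List.Properties using (length-++; concatMap-++; ++-assoc; ++-identityʳ)
open import Data.List.Relation.Unary.All using (All; []; _∷_)
open import Data.List.Relation.Unary.All.Properties using (++⁺)
open import Data.Product using (_×_; _,_; ∃; ∃₂; proj₁; proj₂)
open import Data.Sum using (inj₁; inj₂)
open import Data.Empty using (⊥; ⊥-elim)
open import Relation.Nullary using (¬_; yes; no; contradiction)
open import Relation.Binary.PropositionalEquality

-- Iterates of the morphism and its fixed point.

at-++ˡ : ∀ {A : Set} {d : A} xs {ys i} → i < length xs → at d (xs ++ ys) i ≡ at d xs i
at-++ˡ (x ∷ xs) {i = zero}  _         = refl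
at-++ˡ (x ∷ xs) {i = suc i} (s≤s i<n) = at-++ˡ xs i<n

at-++ʳ : ∀ {A : Set} {d : A} xs {ys} i → at d (xs ++ ys) (length xs + i) ≡ at d ys i
at-++ʳ []       i = refl
at-++ʳ (x ∷ xs) i = at-++ʳ xs i

module Iterates (k : ℕ) where

  d₀ : Letter
  d₀ = 0 , false

  width : Letter → ℕ
  width a = length (ξ k a)

  width>0 : ∀ a → 0 < width a
  width>0 (zero , b) = z<s
  width>0 (suc j , b) with suc (suc j) <? k
  ... | yes _ = z<s
  ... | no  _ = z<s

  offset : List Letter → ℕ → ℕ
  offset []       _       = 0
  offset (a ∷ as) zero    = 0
  offset (a ∷ as) (suc p) = width a + offset as p

  offset-suc : ∀ as {p} → p < length as →
    offset as (suc p) ≡ offset as p + width (at d₀ as p)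
  offset-suc (a ∷ [])      {zero}  _       = +-identityʳ (width a)
  offset-suc (a ∷ a′ ∷ as) {zero}  _       = +-identityʳ (width a)
  offset-suc (a ∷ as)      {suc p} (s≤s p<) =
    trans (cong (width a +_) (offset-suc as p<)) (sym (+-assoc (width a) _ _))

  at-ξ* : ∀ as {p t} → p < length as → t < width (at d₀ as p) →
    at d₀ (ξ* k as) (offset as p + t) ≡ at d₀ (ξ k (at d₀ as p)) t
  at-ξ* (a ∷ as) {zero}      _        t< = at-++ˡ (ξ k a) t<
  at-ξ* (a ∷ as) {suc p} {t} (s≤s p<) t< = trans
    (cong (at d₀ (ξ* k (a ∷ as))) (+-assoc (width a) (offset as p) t))
    (trans (at-++ʳ (ξ k a) (offset as p + t)) (at-ξ* as p< t<))

  offset-bound : ∀ as {p t} → p < length as → t < width (at d₀ as p) →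
    offset as p + t < length (ξ* k as)
  offset-bound (a ∷ as) {zero} {t} _ t< = subst (t <_)
    (sym (length-++ (ξ k a))) (<-≤-trans t< (m≤m+n _ _))
  offset-bound (a ∷ as) {suc p} {t} (s≤s p<) t< = subst₂ _<_
    (sym (+-assoc (width a) _ _)) (sym (length-++ (ξ k a)))
    (+-monoʳ-< (width a) (offset-bound as p< t<))

  ξ*-nonempty : ∀ {as} → 0 < length as → 0 < length (ξ* k as)
  ξ*-nonempty {a ∷ as} _ = subst (0 <_) (sym (length-++ (ξ k a)))
    (<-≤-trans (width>0 a) (m≤m+n _ _))

  iter-suc : ∀ m → ∃ λ r → iter k (suc m) ≡ iter k m ++ r × 0 < length r
  iter-suc zero    = (1 , false) ∷ [] , refl , z<s
  iter-suc (suc m) with iter-suc m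
  ... | r , eq , r>0 = ξ* k r
                     , trans (cong (ξ* k) eq) (concatMap-++ (ξ k) (iter k m) r)
                     , ξ*-nonempty {r} r>0

  iter-length : ∀ m → m < length (iter k m)
  iter-length zero    = z<s
  iter-length (suc m) with iter-suc m
  ... | r , eq , r>0 = subst (suc m <_)
    (sym (trans (cong length eq) (length-++ (iter k m))))
    (subst (_≤ length (iter k m) + length r) (+-comm (suc m) 1)
      (+-mono-≤ (iter-length m) r>0))

  iter-prefix : ∀ m e → ∃ λ r → iter k (e + m) ≡ iter k m ++ r
  iter-prefix m zero    = [] , sym (++-identityʳ (iter k m))
  iter-prefix m (suc e) with iter-prefix m e | iter-suc (e + m)
  ... | r , eq | r′ , eq′ , _ = r ++ r′
    , trans eq′ (trans (cong (_++ r′) eq) (++-assoc (iter k m) r r′))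

  at-iter-mono : ∀ m e {i} → i < length (iter k m) →
    at d₀ (iter k (e + m)) i ≡ at d₀ (iter k m) i
  at-iter-mono m e {i} i< with iter-prefix m e
  ... | r , eq = trans (cong (λ as → at d₀ as i) eq) (at-++ˡ (iter k m) i<)

  -- Both `iter k (suc i)`, which defines `u k i`, and `iter k m` are prefixes of
  -- `iter k (m + suc i)`.
  u-iter : ∀ m {i} → i < length (iter k m) → u k i ≡ at d₀ (iter k m) i
  u-iter m {i} i< = trans
    (sym (at-iter-mono (suc i) m (<-trans (n<1+n i) (iter-length (suc i)))))
    (trans (cong (λ e → at d₀ (iter k e) i) (+-comm m (suc i)))
           (at-iter-mono m (suc i) i<))

  -- φ p = |ξ(u₀ … u_{p-1})|, the position where the image of the p-th letter of u = ξ(u) starts.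
  φ : ℕ → ℕ
  φ zero    = 0
  φ (suc p) = φ p + width (u k p)

  offset-iter : ∀ m {p} → p ≤ length (iter k m) → offset (iter k m) p ≡ φ p
  offset-iter m {zero} _ with iter k m
  ... | []    = refl
  ... | _ ∷ _ = refl
  offset-iter m {suc p} p< = trans (offset-suc (iter k m) p<)
    (cong₂ _+_ (offset-iter m (<⇒≤ p<)) (cong width (sym (u-iter m p<))))

  u-φ : ∀ p {t} → t < width (u k p) → u k (φ p + t) ≡ at d₀ (ξ k (u k p)) t
  u-φ p {t} t< = begin
    u k (φ p + t)                     ≡⟨ cong (λ e → u k (e + t)) (sym off) ⟩
    u k (offset as p + t)             ≡⟨ u-iter (suc p) (offset-bound as p< t<′) ⟩
    at d₀ (ξ* k as) (offset as p + t) ≡⟨ at-ξ* as p< t<′ ⟩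
    at d₀ (ξ k (at d₀ as p)) t        ≡⟨ cong (λ a → at d₀ (ξ k a) t) (sym u≡) ⟩
    at d₀ (ξ k (u k p)) t             ∎
    where
    open ≡-Reasoning
    as = iter k p
    p< = iter-length p
    u≡ : u k p ≡ at d₀ as p
    u≡ = u-iter p p<
    off = offset-iter p (<⇒≤ p<)
    t<′ : t < width (at d₀ as p)
    t<′ = subst (λ a → t < width a) u≡ t<


-- Letters, their bits and their images.

ξ-< : ∀ {k j} b → suc (suc j) < k → ξ k (suc j , b) ≡ (suc (suc j) , b) ∷ []
ξ-< {k} {j} b j< with suc (suc j) <? k
... | yes _ = refl
... | no j≮ = contradiction j< j≮

ξ-≮ : ∀ {k j} b → ¬ suc (suc j) < k → ξ k (suc j , b) ≡ (0 , not b) ∷ []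
ξ-≮ {k} {j} b j≮ with suc (suc j) <? k
... | yes j< = contradiction j< j≮
... | no _   = refl

bit : Letter → Bool
bit (zero  , b) = b
bit (suc _ , b) = not b

π-bit : ∀ a a′ → π a ≡ π a′ → bit a ≡ bit a′
π-bit (zero  , false) (zero  , false) _ = refl
π-bit (zero  , false) (suc _ , true)  _ = refl
π-bit (zero  , true)  (zero  , true)  _ = refl
π-bit (zero  , true)  (suc _ , false) _ = refl
π-bit (suc _ , false) (zero  , true)  _ = refl
π-bit (suc _ , false) (suc _ , false) _ = refl
π-bit (suc _ , true)  (zero  , false) _ = refl
π-bit (suc _ , true)  (suc _ , true)  _ = refl

b≢not-b : ∀ {b} → b ≢ not b
b≢not-b = not-¬ refl

-- Tells whether a preceding 0 starts the image of a 0; the sign of the 1 is then that of the 0.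
isOne : Letter → Bool
isOne (suc zero , _) = true
isOne _              = false

-- U is a fixed point of ξ, and φ p is the position where the image of its p-th letter starts.
-- The three kinds of letters are 0, the letters strictly between 0 and k-1, and k-1 = suc κ.
data Image (κ : ℕ) (U : ℕ → Letter) (φ : ℕ → ℕ) (p : ℕ) : Set where
  double : ∀ b → U p ≡ (0 , b) → φ (suc p) ≡ suc (suc (φ p)) →
           U (φ p) ≡ (0 , b) → U (suc (φ p)) ≡ (1 , b) → Image κ U φ p
  raise  : ∀ j b → U p ≡ (suc j , b) → j < κ → φ (suc p) ≡ suc (φ p) →
           U (φ p) ≡ (suc (suc j) , b) → Image κ U φ p
  wrap   : ∀ b → U p ≡ (suc κ , b) → φ (suc p) ≡ suc (φ p) →
           U (φ p) ≡ (0 , not b) → Image κ U φ p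

module Images (κ : ℕ) where

  k : ℕ
  k = suc (suc κ)

  open Iterates k

  φ-width : ∀ {p a n} → u k p ≡ a → width a ≡ n → φ (suc p) ≡ n + φ p
  φ-width {p} {a} {n} eq w = trans (cong (φ p +_) (trans (cong width eq) w)) (+-comm (φ p) n)

  u-image : ∀ {p a t as} → u k p ≡ a → ξ k a ≡ as → t < length as →
    u k (t + φ p) ≡ at d₀ as t
  u-image {p} {a} {t} {as} eq img t< = trans (cong (u k) (+-comm t (φ p)))
    (trans (u-φ p (subst (λ bs → t < length bs) (sym img′) t<)) (cong (λ bs → at d₀ bs t) img′))
    where
    img′ : ξ k (u k p) ≡ as
    img′ = trans (cong (ξ k) eq) img

  Bounded : Letter → Set
  Bounded a = proj₁ a < k

  ξ-bounded : ∀ a → All Bounded (ξ k a)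
  ξ-bounded (zero , b) = z<s ∷ s≤s z<s ∷ []
  ξ-bounded (suc j , b) with suc (suc j) <? k
  ... | yes j< = j< ∷ []
  ... | no _   = z<s ∷ []

  ξ*-bounded : ∀ as → All Bounded (ξ* k as)
  ξ*-bounded []       = []
  ξ*-bounded (a ∷ as) = ++⁺ (ξ-bounded a) (ξ*-bounded as)

  at-bounded : ∀ {as} → All Bounded as → ∀ i → Bounded (at d₀ as i)
  at-bounded []       _       = z<s
  at-bounded (b ∷ _)  zero    = b
  at-bounded (_ ∷ bs) (suc i) = at-bounded bs i

  u-bounded : ∀ q → Bounded (u k q)
  u-bounded q = at-bounded (ξ*-bounded (iter k q)) q

  image : ∀ p → Image κ (u k) φ p
  image p with u k p in eq
  ... | zero , b = double b eq (φ-width {p} eq refl) (u-image {p} {t = 0} eq refl z<s)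
                     (u-image {p} {t = 1} eq refl (s≤s (s≤s z≤n)))
  ... | suc j , b with j <? κ
  ... | yes j<κ = raise j b eq j<κ (φ-width {p} eq (cong length img)) (u-image {p} {t = 0} eq img z<s)
    where
    img = ξ-< b (s≤s (s≤s j<κ))
  ... | no j≮κ with ≤-antisym (s≤s⁻¹ (s≤s⁻¹ (subst (λ a → proj₁ a < k) eq (u-bounded p)))) (≮⇒≥ j≮κ)
  ... | refl = wrap b eq (φ-width {p} eq (cong length img)) (u-image {p} {t = 0} eq img z<s)
    where
    img = ξ-≮ b (<-irrefl refl)

-- Origins and predecessors of letters in the fixed point.

module FixedPoint (κ : ℕ) (2≤κ : 2 ≤ κ) (U : ℕ → Letter) (φ : ℕ → ℕ) (φ-zero : φ 0 ≡ 0)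
                  (U-zero : U 0 ≡ (0 , false)) (image : ∀ p → Image κ U φ p) where

  clash : ∀ {q a b} → U q ≡ a → U q ≡ b → a ≡ b
  clash eq eq′ = trans (sym eq) eq′

  letter≤ : ∀ {q j b} → U q ≡ (suc j , b) → j ≤ κ
  letter≤ {q} eq with image q
  ... | double _ e _ _ _ with () ← clash e eq
  ... | raise _ _ e j<κ _ _ with refl ← clash e eq = <⇒≤ j<κ
  ... | wrap _ e _ _ with refl ← clash e eq = ≤-refl

  data Position : ℕ → Set where
    first  : ∀ p → Position (φ p)
    second : ∀ p b → U p ≡ (0 , b) → Position (suc (φ p))

  position : ∀ q → Position q
  position zero = subst Position φ-zero (first 0)
  position (suc q) with position q
  ... | second p b eq with image p
  ...   | double _ _ e _ _ = subst Position e (first (suc p))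
  ...   | raise _ _ e _ _ _ with () ← clash e eq
  ...   | wrap _ e _ _ with () ← clash e eq
  position (suc q) | first p with image p
  ...   | double b eq _ _ _ = second p b eq
  ...   | raise _ _ _ _ e _ = subst Position e (first (suc p))
  ...   | wrap _ _ e _ = subst Position e (first (suc p))

  infix 4 _not-one
  _not-one : ℕ → Set
  q not-one = ∀ b → U q ≢ (1 , b)

  image-not-one : ∀ p → φ p not-one
  image-not-one p c eq with image p
  ... | double _ _ _ e _ with () ← clash e eq
  ... | raise _ _ _ _ _ e with () ← clash e eq
  ... | wrap _ _ _ e with () ← clash e eq

  φ-suc-> : ∀ p → φ p < φ (suc p)
  φ-suc-> p with image p
  ... | double _ _ e _ _ = subst (φ p <_) (sym e) (<-trans (n<1+n _) (n<1+n _))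
  ... | raise _ _ _ _ e _ = subst (φ p <_) (sym e) (n<1+n _)
  ... | wrap _ _ e _ = subst (φ p <_) (sym e) (n<1+n _)

  φ-mono-≤ : ∀ p d → φ p ≤ φ (p + d)
  φ-mono-≤ p zero    = ≤-reflexive (cong φ (sym (+-identityʳ p)))
  φ-mono-≤ p (suc d) = ≤-trans (φ-mono-≤ p d)
    (subst (φ (p + d) ≤_) (cong φ (sym (+-suc p d))) (<⇒≤ (φ-suc-> (p + d))))

  φ-< : ∀ {p q} → φ p < φ q → p < q
  φ-< {p} {q} lt with q ≤? p
  ... | no q≰p = ≰⇒> q≰p
  ... | yes q≤p = contradiction (<-≤-trans lt (subst (λ e → φ q ≤ φ e) (m+[n∸m]≡n q≤p) (φ-mono-≤ q (p ∸ q)))) (<-irrefl refl)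

  φ-mono-< : ∀ {p q} → p < q → φ p < φ q
  φ-mono-< {p} {q} p<q = <-≤-trans (φ-suc-> p)
    (subst (λ e → φ (suc p) ≤ φ e) (m+[n∸m]≡n p<q) (φ-mono-≤ (suc p) (q ∸ suc p)))

  φ-injective : ∀ {p q} → φ p ≡ φ q → p ≡ q
  φ-injective {p} {q} eq with p ≤? q | q ≤? p
  ... | yes p≤q | yes q≤p = ≤-antisym p≤q q≤p
  ... | no p≰q  | _       = contradiction (φ-mono-< (≰⇒> p≰q)) (<-irrefl (sym eq))
  ... | _       | no q≰p  = contradiction (φ-mono-< (≰⇒> q≰p)) (<-irrefl eq)

  -- The initial 0 has an image of two letters, and no image is empty. This growth makes
  -- desubstitution lower the induction measure.
  φ-expanding : ∀ p → suc p < φ (suc p)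
  φ-expanding zero with image 0
  ... | double _ _ e _ _ = subst (1 <_) (sym (trans e (cong (λ q → suc (suc q)) φ-zero))) (n<1+n 1)
  ... | raise _ _ e _ _ _ with () ← clash e U-zero
  ... | wrap _ e _ _ with () ← clash e U-zero
  φ-expanding (suc p) = ≤-<-trans (φ-expanding p) (φ-suc-> (suc p))

  data ZeroOrigin (q : ℕ) (s : Bool) : Set where
    from-zero : ∀ p → φ p ≡ q → U p ≡ (0 , s) → φ (suc p) ≡ suc (suc q) →
                U (suc q) ≡ (1 , s) → ZeroOrigin q s
    from-last : ∀ p → φ p ≡ q → U p ≡ (suc κ , not s) → φ (suc p) ≡ suc q →
                ZeroOrigin q s

  zero-origin : ∀ {q s} → U q ≡ (0 , s) → ZeroOrigin q s
  zero-origin {q} eq with position q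
  zero-origin eq | second p b e with image p
  ... | double _ _ _ _ e′ with () ← clash e′ eq
  ... | raise _ _ e′ _ _ _ with () ← clash e e′
  ... | wrap _ e′ _ _ with () ← clash e e′
  zero-origin eq | first p with image p
  ... | double _ e₀ e₁ e₂ e₃ with refl ← clash e₂ eq = from-zero p refl e₀ e₁ e₃
  ... | raise _ _ _ _ _ e with () ← clash e eq
  ... | wrap b e₀ e₁ e with refl ← clash e eq =
    from-last p refl (trans e₀ (cong (suc κ ,_) (sym (not-involutive b)))) e₁

  one-origin : ∀ {q s} → U q ≡ (1 , s) → ∃ λ p → suc (φ p) ≡ q × U p ≡ (0 , s) × φ (suc p) ≡ suc q × U (φ p) ≡ (0 , s)
  one-origin {q} eq with position q
  one-origin eq | first p = ⊥-elim (image-not-one p _ eq)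
  one-origin eq | second p b e with image p
  ... | double _ e₀ e₁ e₂ e₃ with refl ← clash e₃ eq = p , refl , e₀ , e₁ , e₂
  ... | raise _ _ e′ _ _ _ with () ← clash e e′
  ... | wrap _ e′ _ _ with () ← clash e e′

  raised-origin : ∀ {q j s} → U q ≡ (suc (suc j) , s) →
    ∃ λ p → φ p ≡ q × U p ≡ (suc j , s) × φ (suc p) ≡ suc q
  raised-origin {q} eq with position q
  raised-origin eq | second p b e with image p
  ... | double _ _ _ _ e′ with () ← clash e′ eq
  ... | raise _ _ e′ _ _ _ with () ← clash e e′
  ... | wrap _ e′ _ _ with () ← clash e e′
  raised-origin eq | first p with image p
  ... | double _ _ _ e _ with () ← clash e eq
  ... | raise _ _ e₀ _ e₁ e with refl ← clash e eq = p , refl , e₀ , e₁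
  ... | wrap b _ _ e with () ← clash e eq

  -- A 1 occurs only as the second letter of the image of a 0. A letter `j + 2` is the image of
  -- `j + 1`, which by induction follows `j`, and the image of `j` ends in `j + 1`.
  predecessor : ∀ j {q s} → U q ≡ (suc j , s) → ∃ λ q′ → q ≡ suc q′ × U q′ ≡ (j , s)
  predecessor zero eq with one-origin eq
  ... | p , e , _ , _ , e₀ = φ p , sym e , e₀
  predecessor (suc j) eq with raised-origin eq
  ... | p , refl , e₀ , _ with predecessor j e₀
  ... | p′ , refl , e₁ with image p′
  ... | double _ e₂ e₃ _ e₄ with refl ← clash e₂ e₁ = suc (φ p′) , e₃ , e₄
  ... | raise _ _ e₂ _ e₃ e₄ with refl ← clash e₂ e₁ = φ p′ , e₃ , e₄
  ... | wrap b e₂ _ _ with refl ← clash e₂ e₁ = contradiction (letter≤ e₀) (<⇒≱ (n<1+n κ))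

  predecessor′ : ∀ {j q s} → U (suc q) ≡ (suc j , s) → U q ≡ (j , s)
  predecessor′ {j} eq with predecessor j eq
  ... | _ , refl , e = e

  data Next (q j : ℕ) (s : Bool) : Set where
    up   : U (suc q) ≡ (suc j , s) → Next q j s
    zero : ∀ t → U (suc q) ≡ (0 , t) → Next q j s

  next : ∀ {q j s} → U q ≡ (j , s) → Next q j s
  next {q} eq with U (suc q) in e
  ... | zero , t  = zero t e
  ... | suc i , t with refl ← clash (predecessor′ e) eq = up e

  -- A 0 not followed by 1 is the image of a letter `k-1` of opposite sign. This one is preceded by
  -- `k-2`, nonzero since `κ ≥ 2`, whose image is `k-1`. In particular three zeros in a row never
  -- occur.
  before-0-0 : ∀ {q s t} → U (suc q) ≡ (0 , s) → U (suc (suc q)) ≡ (0 , t) → U q ≡ (suc κ , not s)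
  before-0-0 {q} e₀ e₁ with zero-origin e₀
  ... | from-zero _ _ _ _ e with () ← clash e e₁
  ... | from-last zero φp _ _ with () ← trans (sym φ-zero) φp
  ... | from-last (suc p) φp e _ with image p
  ...   | double _ e₂ _ _ _ with refl ← clash (predecessor′ e) e₂ = contradiction 2≤κ (λ ())
  ...   | raise j _ e₂ _ e₃ e₄ with refl ← clash e₂ (predecessor′ e) =
            trans (cong U (suc-injective (trans (sym φp) e₃))) e₄
  ...   | wrap _ e₂ _ _ with () ← <-irrefl (cong proj₁ (clash (predecessor′ e) e₂)) (n<1+n κ)

  -- The `01` is the image of a 0, and the next image starts with 0. As the image of 1 is 2, this
  -- ancestor is followed by another 0, hence preceded by `k-1` of opposite sign, which maps to 0 of
  -- sign `s`.
  before-01-0 : ∀ {q s t} → U (suc q) ≡ (0 , s) → U (suc (suc q)) ≡ (1 , s) →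
    U (suc (suc (suc q))) ≡ (0 , t) → U q ≡ (0 , s)
  before-01-0 {q} e₀ e₁ e₂ with zero-origin e₀
  ... | from-last p _ _ φp = ⊥-elim (image-not-one (suc p) _ (trans (cong U φp) e₁))
  ... | from-zero zero φp _ _ _ with () ← trans (sym φ-zero) φp
  ... | from-zero (suc p) φp e φp′ _ with next e
  ...   | up e′ with image (suc (suc p))
  ...     | double _ e″ _ _ _ with () ← clash e′ e″
  ...     | raise _ _ _ _ _ e″ with () ← clash (trans (cong U φp′) e₂) e″
  ...     | wrap _ e″ _ _ with refl ← clash e′ e″ = contradiction 2≤κ (λ ())
  before-01-0 {q} e₀ e₁ e₂ | from-zero (suc p) φp e φp′ _ | zero t e′ with image p
  ...   | wrap b e″ φp″ e‴ with refl ← clash e″ (before-0-0 e e′) =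
            trans (cong U (suc-injective (trans (sym φp) φp″))) (trans e‴ (cong (0 ,_) (not-involutive _)))
  ...   | double _ e″ _ _ _ with () ← clash e″ (before-0-0 e e′)
  ...   | raise _ _ e″ j< _ _ with refl ← clash e″ (before-0-0 e e′) = contradiction j< (<-irrefl refl)

  -- Desubstitution

  isOne-image : ∀ p → isOne (U (φ p)) ≡ false
  isOne-image p with image p
  ... | double _ _ _ e _  = cong isOne e
  ... | raise _ _ _ _ _ e = cong isOne e
  ... | wrap _ _ _ e      = cong isOne e

  zero-image : ∀ {p s} → U p ≡ (0 , s) → U (φ p) ≡ (0 , s)
  zero-image {p} eq with image p
  ... | double _ e _ e′ _ with refl ← clash e eq = e′
  ... | raise _ _ e _ _ _ with () ← clash e eq
  ... | wrap _ e _ _ with () ← clash e eq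

  φ-≥ : ∀ p → p ≤ φ p
  φ-≥ zero    = z≤n
  φ-≥ (suc p) = <⇒≤ (φ-expanding p)

  -- A letter is recovered from the first letter of its image
  -- and from whether the letter 1 comes next; letters 1 do not start an image.
  preimage : Letter → Bool → Letter
  preimage (zero        , b) true  = 0 , b
  preimage (zero        , b) false = suc κ , not b
  preimage (suc zero    , b) _     = 0 , b
  preimage (suc (suc j) , b) _     = suc j , b

  preimage-φ : ∀ p → preimage (U (φ p)) (isOne (U (suc (φ p)))) ≡ U p
  preimage-φ p with image p
  ... | double _ e₀ _ e₁ e₂ = trans (cong₂ preimage e₁ (cong isOne e₂)) (sym e₀)
  ... | raise _ _ e₀ _ _ e₁ = trans (cong (λ a → preimage a (isOne (U (suc (φ p))))) e₁) (sym e₀)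
  -- The image has one letter, so the next position starts an image and cannot carry a 1.
  ... | wrap b e₀ e₁ e₂     = trans
    (cong₂ preimage e₂ (trans (cong (λ q → isOne (U q)) (sym e₁)) (isOne-image (suc p))))
    (trans (cong (suc κ ,_) (not-involutive b)) (sym e₀))

  size : Letter → ℕ
  size (zero  , _) = 2
  size (suc _ , _) = 1

  φ-suc : ∀ p → φ (suc p) ≡ φ p + size (U p)
  φ-suc p with image p
  ... | double _ e₀ e₁ _ _  = trans e₁ (trans (+-comm 2 (φ p)) (cong (λ a → φ p + size a) (sym e₀)))
  ... | raise _ _ e₀ _ e₁ _ = trans e₁ (trans (+-comm 1 (φ p)) (cong (λ a → φ p + size a) (sym e₀)))
  ... | wrap _ e₀ e₁ _      = trans e₁ (trans (+-comm 1 (φ p)) (cong (λ a → φ p + size a) (sym e₀)))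

  Match : ℕ → ℕ → ℕ → Set
  Match a b m = ∀ t → t < m → U (a + t) ≡ U (b + t)

  match-≤ : ∀ {a b m n} → m ≤ n → Match a b n → Match a b m
  match-≤ m≤n M t t<m = M t (<-≤-trans t<m m≤n)

  match-right : ∀ {a b} m → Match a b m → U (a + m) ≡ U (b + m) → Match a b (suc m)
  match-right m M e t t< with m<1+n⇒m<n∨m≡n t<
  ... | inj₁ t<m  = M t t<m
  ... | inj₂ refl = e

  match-left : ∀ {a b m} → Match (suc a) (suc b) m → U a ≡ U b → Match a b (suc m)
  match-left {a} {b} M e zero _ = trans (cong U (+-identityʳ a)) (trans e (cong U (sym (+-identityʳ b))))
  match-left {a} {b} M e (suc t) (s≤s t<) = trans (cong U (+-suc a t)) (trans (M t t<) (cong U (sym (+-suc b t))))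

  match-head : ∀ {a b m} → 0 < m → Match a b m → U a ≡ U b
  match-head {a} {b} 0<m M = trans (cong U (sym (+-identityʳ a))) (trans (M 0 0<m) (cong U (+-identityʳ b)))

  φ-+ : ∀ {a m x} → φ (a + m) ≡ x → φ (a + suc m) ≡ x + size (U (a + m))
  φ-+ {a} {m} eq = trans (cong φ (+-suc a m)) (trans (φ-suc (a + m)) (cong (_+ size (U (a + m))) eq))

  φ-+-> : ∀ a m → φ (a + m) < φ (a + suc m)
  φ-+-> a m = φ-mono-< (subst (a + m <_) (sym (+-suc a m)) (n<1+n _))

  -- Both windows are decoded from left to right by `preimage`. Equal letters have images of equal
  -- length, so the image boundaries stay at a common offset `d`.
  desubstitute : ∀ {a b L} → Match (φ a) (φ b) L → isOne (U (φ a + L)) ≡ isOne (U (φ b + L)) →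
    ∀ m → φ (a + m) ≤ φ a + L →
    Match a b m × ∃ λ d → φ (a + m) ≡ φ a + d × φ (b + m) ≡ φ b + d
  desubstitute {a} {b} M end zero _ = (λ _ ()) , 0
    , trans (cong φ (+-identityʳ a)) (sym (+-identityʳ _))
    , trans (cong φ (+-identityʳ b)) (sym (+-identityʳ _))
  desubstitute {a} {b} {L} M end (suc m) φ≤
    with desubstitute M end m (<⇒≤ (<-≤-trans (φ-+-> a m) φ≤))
  ... | M′ , d , φa , φb = match-right m M′ letter , d + size (U (a + m))
      , trans (φ-+ {a} {m} φa) (+-assoc (φ a) d _)
      , trans (φ-+ {b} {m} φb) (trans (+-assoc (φ b) d _) (cong (λ c → φ b + (d + size c)) (sym letter)))
    where
    d<L : d < L
    d<L = +-cancelˡ-< (φ a) d L (subst (_< φ a + L) φa (<-≤-trans (φ-+-> a m) φ≤))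
    -- Decoding looks one letter ahead; at the end of the windows this letter lies outside them, and
    -- only `end` is known about it.
    after : isOne (U (φ a + suc d)) ≡ isOne (U (φ b + suc d))
    after with m≤n⇒m<n∨m≡n d<L
    ... | inj₁ lt   = cong isOne (M (suc d) lt)
    ... | inj₂ refl = end
    letter : U (a + m) ≡ U (b + m)
    letter = trans (sym (preimage-φ (a + m))) (trans (cong₂ preimage
      (trans (cong U φa) (trans (M d d<L) (cong U (sym φb))))
      (trans (cong (λ q → isOne (U q)) (trans (cong suc φa) (sym (+-suc (φ a) d))))
        (trans after (cong (λ q → isOne (U q)) (trans (+-suc (φ b) d) (cong suc (sym φb)))))))
      (preimage-φ (b + m)))

  -- The left window ends at an image boundary, where no 1 can stand, so only the right end needs an
  -- assumption.
  desubstitute-to : ∀ {a b L m} → Match (φ a) (φ b) L → isOne (U (φ b + L)) ≡ false →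
    φ (a + m) ≡ φ a + L → Match a b m × φ (b + m) ≡ φ b + L
  desubstitute-to {a} {b} {L} {m} M end φa
    with desubstitute M (trans (trans (cong (λ q → isOne (U q)) (sym φa)) (isOne-image (a + m))) (sym end))
           m (≤-reflexive φa)
  ... | M′ , d , φa′ , φb = M′ , trans φb (cong (φ b +_) (+-cancelˡ-≡ (φ a) d L (trans (sym φa′) φa)))

  -- Squares of u

  -- The letters that may come after a square starting with 0 of sign `s`. All have bit `not s`,
  -- whereas continuing the period in `x` would need bit `s`.
  data Follows (s : Bool) : Letter → Set where
    flipped : Follows s (0 , not s)
    letter  : ∀ j → Follows s (suc j , s)

  follows-zero : ∀ {s} → ¬ Follows s (0 , s)
  follows-zero {s} F = go F refl
    where
    go : ∀ {a} → Follows s a → a ≢ (0 , s)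
    go flipped eq = b≢not-b (sym (cong proj₂ eq))
    go (letter _) ()

  follows-flip : ∀ {s j} → ¬ Follows s (suc j , not s)
  follows-flip {s} F = go F refl
    where
    go : ∀ {a j} → Follows s a → a ≢ (suc j , not s)
    go (letter _) eq = b≢not-b (cong proj₂ eq)

  follows-φ : ∀ {s} p → Follows s (U p) → Follows s (U (φ p))
  follows-φ {s} p F with image p
  ... | double b e _ e′ _ = subst (Follows s) (trans e (sym e′)) F
  ... | raise j b e _ _ e′ with letter _ ← subst (Follows s) e F = subst (Follows s) (sym e′) (letter _)
  ... | wrap b e _ e′ with letter _ ← subst (Follows s) e F = subst (Follows s) (sym e′) flipped

  SquareStartsAtZero : ℕ → ℕ → Set
  SquareStartsAtZero p h = Match p (p + suc h) (suc h) →
    ∃ λ s → U p ≡ (0 , s) × Follows s (U (p + suc h + suc h))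

  -- Without `0 < h` this would fail for a letter `k-1` and a 0 of opposite sign right after it.
  NoAlmostSquare : ℕ → ℕ → Set
  NoAlmostSquare p h = 0 < h → Match p (p + suc h) h → ∀ {j s} →
    U (p + h) ≡ (suc j , not s) → U (p + suc h + h) ≡ (0 , s) → ⊥

  square-left : ∀ {p h} → Match (suc p) (suc p + suc h) h → U p ≡ U (suc p + h) →
    Match p (p + suc h) (suc h)
  square-left {p} {h} M e = match-left M (trans e (cong U (sym (+-suc p h))))

  -- The repeated word starts with the letter after the 0 at `p + h`. If this is 1, both copies
  -- extend to the left by 0, giving a square followed by a letter of the wrong sign. If it is 0,
  -- the word ends in `k-1`, and its second copy would be followed by `k`.
  no-almost-square′ : ∀ {p h j s} → (∀ {p′} → p ≡ suc p′ → SquareStartsAtZero p′ h) →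
    0 < h → Match p (p + suc h) h → U (p + h) ≡ (0 , s) → U (p + suc h + h) ≡ (suc j , not s) → ⊥
  no-almost-square′ {p} {h} {j} {s} sq 0<h M e₀ e₁ with next e₀
  ... | up e with predecessor 0 (trans (match-head 0<h M) (trans (cong U (+-suc p h)) e))
  ...   | p′ , refl , e′ with sq refl (square-left M (trans e′ (sym e₀)))
  ...     | s′ , e″ , F with refl ← clash e″ e′ =
              follows-flip (subst (Follows s) (trans (cong U (+-suc (p′ + suc h) h)) e₁) F)
  no-almost-square′ {p} {suc h} {j} {s} sq 0<h M e₀ e₁ | zero t e
    with refl ← clash (predecessor′ (trans (cong U (sym (+-suc (p + suc (suc h)) h))) e₁))
                      (trans (sym (M h (n<1+n h)))
                        (before-0-0 (trans (cong U (sym (+-suc p h))) e₀)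
                                    (trans (cong (λ q → U (suc q)) (sym (+-suc p h))) e)))
    = contradiction (letter≤ e₁) (<⇒≱ (n<1+n κ))

  -- The measure is essentially start plus period: a shift to the left lowers the start, and
  -- desubstitution lowers the sum because `φ` is expanding.
  Smaller : ℕ → ℕ → Set
  Smaller p h = ∀ p′ h′ → p′ + h′ < p + h → SquareStartsAtZero p′ h′ × NoAlmostSquare p′ h′

  φ-> : ∀ {p} → 0 < p → p < φ p
  φ-> {suc p} _ = φ-expanding p

  <-split : ∀ {p q} → p < q → ∃ λ d → q ≡ p + suc d
  <-split {p} p<q with m≤n⇒∃[o]m+o≡n p<q
  ... | d , refl = d , sym (+-suc p d)

  origins : ∀ {p h s} → U p ≡ (0 , s) → U (p + suc h) ≡ (0 , s) →
    ∃₂ λ p′ o → φ p′ ≡ p × φ (p′ + suc o) ≡ p + suc h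
  origins {p} {h} e e′ with position-zero e | position-zero e′
    where
    position-zero : ∀ {q s} → U q ≡ (0 , s) → ∃ λ q′ → φ q′ ≡ q
    position-zero eq with zero-origin eq
    ... | from-zero q′ φq′ _ _ _ = q′ , φq′
    ... | from-last q′ φq′ _ _   = q′ , φq′
  ... | p′ , φp′ | r′ , φr′
    with <-split (φ-< {p′} {r′} (subst₂ _<_ (sym φp′) (sym φr′) (m<m+n p z<s)))
  ... | o , refl = p′ , o , φp′ , φr′

  offset>0 : ∀ p {o} → φ p < φ (p + o) → 0 < o
  offset>0 p {zero}  lt = contradiction lt (<-irrefl (cong φ (sym (+-identityʳ p))))
  offset>0 p {suc o} _  = z<s

  no-almost-square : ∀ p h → Smaller p h → NoAlmostSquare p h
  no-almost-square p h ih 0<h M {j} {s} e₀ e₁ with U p in e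
  -- The letters at `p′` and at `p + h` precede the same nonzero letter, so they coincide, and there
  -- is a square at `p′` starting with a nonzero letter.
  ... | suc i , t with predecessor i e
  ...   | p′ , refl , e′
    with clash (predecessor′ (trans (cong U (sym (+-suc (suc p′) h))) (trans (sym (match-head 0<h M)) e))) e₀
  ...     | refl with proj₁ (ih p′ h ≤-refl) (square-left M (trans e′ (sym e₀)))
  ...       | _ , e″ , _ with () ← clash e′ e″
  no-almost-square p (suc h) ih 0<h M {j} {s} e₀ e₁ | zero , t
    with origins e (trans (sym (match-head 0<h M)) e)
  -- The last letter of the first window is at least 2, hence a whole image. The 0 opposite comes
  -- from a 0, giving a shorter almost square, or from `k-1`; then comparing predecessors turns the
  -- former letter into `k`.
  no-almost-square _ (suc h) ih 0<h M {suc j} {s} e₀ e₁ | zero , t | p′ , o , refl , φr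
    with raised-origin e₀
  ... | c , φc , e′ , φc′
    with refl ← φ-injective {p = suc c} {q = suc (p′ + o)} (trans φc′ (trans (sym (+-suc (φ p′) (suc h))) (trans (sym φr) (cong φ (+-suc p′ o)))))
    with desubstitute-to {a = p′} {b = p′ + suc o} {L = suc h} {m = o}
           (subst (λ q → Match (φ p′) q (suc h)) (sym φr) M)
           (trans (cong (λ q → isOne (U (q + suc h))) φr) (cong isOne e₁)) φc
  ... | M′ , φo with offset>0 p′ (subst (φ p′ <_) (sym φc) (m<m+n (φ p′) z<s))
  ...   | 0<o with zero-origin (trans (cong U (trans φo (cong (_+ suc h) φr))) e₁)
  ...     | from-zero p₂ φ₂ e₂ _ _ with refl ← φ-injective φ₂ =
              proj₂ (ih p′ o (subst (p′ + o <_) φc (φ-> (<-≤-trans 0<o (m≤n+m o p′))))) 0<o M′ e′ e₂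
  no-almost-square _ (suc h) ih 0<h M {suc j} {s} e₀ e₁ | zero , t | p′ , o@(suc o′) , refl , φr
    | c , φc , e′ , φc′ | M′ , φo | _ | from-last p₂ φ₂ e₂ _ with refl ← φ-injective φ₂
    with refl ← clash (predecessor′ (trans (cong U (sym (+-suc (p′ + suc o) o′))) e₂))
                  (trans (sym (M′ o′ (n<1+n o′))) (predecessor′ (trans (cong U (sym (+-suc p′ o′))) e′)))
    = contradiction (letter≤ e₀) (<⇒≱ (n<1+n κ))
  -- Here the first window ends in 1, inside an image, so the cut moves one letter to the left. The
  -- 0 there comes from a 0 in the first window and from `k-1` in the second: a mirrored almost
  -- square.
  no-almost-square _ (suc h) ih 0<h M {zero} {s} e₀ e₁ | zero , t | p′ , o , refl , φr
    with one-origin e₀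
  ... | e , φe , e′ , φe′ , e″
    with refl ← φ-injective {p = suc e} {q = suc (p′ + o)} (trans φe′ (trans (sym (+-suc (φ p′) (suc h))) (trans (sym φr) (cong φ (+-suc p′ o)))))
    = last-step
    where
    φe″ : φ (p′ + o) ≡ φ p′ + h
    φe″ = suc-injective (trans φe (+-suc (φ p′) h))
    e₃ : U (φ p′ + suc (suc h) + h) ≡ (0 , not s)
    e₃ = trans (sym (M h (n<1+n h))) (trans (cong U (sym φe″)) e″)
    desub : Match p′ (p′ + suc o) o × φ (p′ + suc o + o) ≡ φ (p′ + suc o) + h
    desub = desubstitute-to (subst (λ q → Match (φ p′) q h) (sym φr) (match-≤ (n≤1+n h) M))
              (trans (cong (λ q → isOne (U (q + h))) φr) (cong isOne e₃)) φe″
    e₄ : U (p′ + suc o + o) ≡ (suc κ , not (not s))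
    e₄ with zero-origin (trans (cong U (trans (proj₂ desub) (cong (_+ h) φr))) e₃)
    ... | from-last p₂ φ₂ e₂ _ with refl ← φ-injective φ₂ = e₂
    ... | from-zero p₂ φ₂ e₂ _ e₅ with () ← clash e₅ (trans (cong U (sym
            (trans (+-suc (φ p′ + suc (suc h)) h) (cong suc (sym (trans (proj₂ desub) (cong (_+ h) φr))))))) e₁)
    0<o : ∀ o → U (p′ + o) ≡ (0 , not s) → U (p′ + suc o + o) ≡ (suc κ , not (not s)) → 0 < o
    0<o (suc o) _ _ = z<s
    0<o zero e₅ e₆ = contradiction (subst (2 ≤_) κ≡0 2≤κ) (λ ())
      where
      κ≡0 : κ ≡ 0
      κ≡0 = cong proj₁ (clash
        (predecessor′ (trans (cong U (sym (trans (+-identityʳ (p′ + 1)) (+-comm p′ 1)))) e₆))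
        (trans (cong U (sym (+-identityʳ p′))) e₅))
    last-step : ⊥
    last-step = no-almost-square′
      (λ { {p″} refl → proj₁ (ih p″ o (<-trans (n<1+n _) (≤-<-trans (φ-≥ (p′ + o))
        (subst (_< φ p′ + suc h) (sym φe″) (+-monoʳ-< (φ p′) (n<1+n h)))))) })
      (0<o o e′ e₄) (proj₁ desub) e′ e₄

  data One? (q : ℕ) : Set where
    one     : ∀ t → U q ≡ (1 , t) → One? q
    not-one : isOne (U q) ≡ false → One? q

  one? : ∀ q → One? q
  one? q with U q in e
  ... | zero , t        = not-one (cong isOne e)
  ... | suc zero , t    = one t e
  ... | suc (suc _) , t = not-one (cong isOne e)

  square-starts-at-zero : ∀ p h → Smaller p h → SquareStartsAtZero p h
  square-starts-at-zero p h ih M with U p in e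
  ... | suc j , s with predecessor j e
  -- The square shifted to `p′` would be followed by its own first letter, a 0 of the same sign,
  -- which `Follows` excludes.
  ...   | p′ , refl , e′ = contradiction
    (subst (Follows s′) (trans (cong U (+-suc (p′ + suc h) h)) (trans (sym (M h (n<1+n h))) e₂)) F) follows-zero
    where
    e₁ : U (suc p′ + h) ≡ (j , s)
    e₁ = predecessor′ (trans (cong U (sym (+-suc (suc p′) h))) (trans (sym (match-head z<s M)) e))
    smaller = proj₁ (ih p′ h ≤-refl) (square-left (match-≤ (n≤1+n h) M) (trans e′ (sym e₁)))
    s′ = proj₁ smaller
    F = proj₂ (proj₂ smaller)
    e₂ : U (suc p′ + h) ≡ (0 , s′)
    e₂ = trans e₁ (trans (sym e′) (proj₁ (proj₂ smaller)))
  square-starts-at-zero p zero ih M | zero , s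
    with e₁ ← trans (cong U (+-comm 1 p)) (trans (sym (match-head z<s M)) e) | next e₁
  ... | up e₂ = s , refl , subst (Follows s) (sym (trans (cong U (trans (+-assoc p 1 1) (+-comm p 2))) e₂)) (letter 0)
  ... | zero t e₂ with () ← clash e (before-0-0 e₁ e₂)
  square-starts-at-zero p (suc h) ih M | zero , s with origins e (trans (sym (match-head z<s M)) e)
  ... | p′ , o , refl , φr with one? (φ p′ + suc (suc h) + suc (suc h))
  -- Both copies end at image boundaries, so the square is the image of a shorter one.
  ...   | not-one end = s , refl , subst (Follows s) (cong U (trans φo (cong (_+ suc (suc h)) φr)))
            (follows-φ _ (subst (λ b → Follows b (U (p′ + suc o + suc o))) s′≡s (proj₂ (proj₂ smaller))))
    where
    desub : Match p′ (p′ + suc o) (suc o) × φ (p′ + suc o + suc o) ≡ φ (p′ + suc o) + suc (suc h)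
    desub = desubstitute-to (subst (λ q → Match (φ p′) q (suc (suc h))) (sym φr) M)
              (trans (cong (λ q → isOne (U (q + suc (suc h)))) φr) end) φr
    φo = proj₂ desub
    smaller = proj₁ (ih p′ o (s≤s⁻¹ (subst₂ _<_ (+-suc p′ o) (trans φr (+-suc (φ p′) (suc h)))
                (φ-> (≤-trans z<s (m≤n+m (suc o) p′)))))) (proj₁ desub)
    s′≡s : proj₁ smaller ≡ s
    s′≡s = cong proj₂ (clash (zero-image (proj₁ (proj₂ smaller))) e)
  -- The square ends inside the image of a 0. The last letter of its first copy is followed by 0 and
  -- so comes from `k-1`: the ancestors form an almost square.
  ...   | one t e₂ = ⊥-elim absurd
    where
    H = suc h
    e₃ : U (φ p′ + suc H + H) ≡ (0 , t)
    e₃ = predecessor′ (trans (cong U (sym (+-suc (φ p′ + suc H) H))) e₂)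
    absurd : ⊥
    absurd with zero-origin (trans (M H (n<1+n H)) e₃)
    ... | from-zero _ _ _ _ e₄
      with () ← clash e₄ (trans (cong U (sym (+-suc (φ p′) H))) (trans (sym (match-head z<s M)) e))
    ... | from-last g φg e₄ φg′
      with refl ← φ-injective {p = suc g} {q = suc (p′ + o)} (trans φg′ (trans (sym (+-suc (φ p′) H)) (trans (sym φr) (cong φ (+-suc p′ o)))))
      with desubstitute-to {L = H} {m = o} (subst (λ q → Match (φ p′) q H) (sym φr) (match-≤ (n≤1+n H) M))
             (trans (cong (λ q → isOne (U (q + H))) φr) (cong isOne e₃)) φg
         | offset>0 p′ (subst (φ p′ <_) (sym φg) (m<m+n (φ p′) z<s))
    ... | M′ , φo | 0<o with zero-origin (trans (cong U (trans φo (cong (_+ H) φr))) e₃)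
    ...   | from-zero g′ φg″ e₅ _ _ with refl ← φ-injective φg″ =
              proj₂ (ih p′ o (subst (p′ + o <_) φg (φ-> (<-≤-trans 0<o (m≤n+m o p′))))) 0<o M′ e₄ e₅
    ...   | from-last g′ _ _ φg″ = image-not-one (suc g′) t
              (trans (cong U (trans φg″ (trans (cong suc (trans φo (cong (_+ H) φr))) (sym (+-suc (φ p′ + suc H) H))))) e₂)

  squares : ∀ N p h → p + h < N → SquareStartsAtZero p h × NoAlmostSquare p h
  squares (suc N) p h (s≤s le) = square-starts-at-zero p h smaller , no-almost-square p h smaller
    where
    smaller : Smaller p h
    smaller p′ h′ lt = squares N p′ h′ (<-≤-trans lt le)

  -- Recovering u from x

  sign-clash : ∀ {q i j s} → U q ≡ (i , s) → U q ≡ (j , not s) → ⊥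
  sign-clash e e′ = b≢not-b (cong proj₂ (clash e e′))

  1≢sucκ : ∀ {b c : Bool} → _≢_ {A = Letter} (1 , b) (suc κ , c)
  1≢sucκ refl = contradiction 2≤κ λ ()

  Agree : ℕ → ℕ → Set
  Agree a b = bit (U a) ≡ bit (U b)

  agree-as : ∀ {a b c d} → Agree a b → U a ≡ c → U b ≡ d → bit c ≡ bit d
  agree-as ag e e′ = trans (cong bit (sym e)) (trans ag (cong bit e′))

  -- The nonzero letter of sign `s` before it forces the 0 at `1 + b` to begin `012`. The bits of 1
  -- and 2 would force two zeros after the `01` at `a`, but `00` is preceded by `k-1` only.
  01-vs-j0 : ∀ {a b j s} → U a ≡ (0 , not s) → U (1 + a) ≡ (1 , not s) →
    U b ≡ (suc j , s) → U (1 + b) ≡ (0 , s) → Agree (2 + a) (2 + b) → Agree (3 + a) (3 + b) → ⊥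
  01-vs-j0 a₀ a₁ b₀ b₁ ag₂ ag₃ with next b₁
  ... | zero _ b₂ = sign-clash b₀ (before-0-0 b₁ b₂)
  ... | up b₂ with next b₂
  ...   | zero _ b₃ with () ← clash b₀ (before-01-0 b₁ b₂ b₃)
  ...   | up b₃ with next a₁
  ...     | up a₂ = b≢not-b (sym (agree-as ag₂ a₂ b₂))
  ...     | zero t a₂ with refl ← agree-as ag₂ a₂ b₂ with next a₂
  ...       | up a₃ = b≢not-b (sym (agree-as ag₃ a₃ b₃))
  ...       | zero _ a₃ = 1≢sucκ (clash a₁ (before-0-0 a₂ a₃))

  -- Otherwise `01` would stand against a nonzero letter and a 0, at once or one step later. The
  -- later case reads one more letter, but needs a letter `j + 2` and so `j < κ`.
  resync : ∀ {a b j s} → U a ≡ (0 , not s) → U b ≡ (suc j , s) →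
    Agree (1 + a) (1 + b) → Agree (2 + a) (2 + b) → Agree (3 + a) (3 + b) →
    (j < κ → Agree (4 + a) (4 + b)) → U (1 + a) ≡ U (1 + b)
  resync {s = s} a₀ b₀ ag₁ ag₂ ag₃ ag₄ with next a₀ | next b₀
  ... | up a₁ | up b₁ = ⊥-elim (b≢not-b (sym (agree-as ag₁ a₁ b₁)))
  ... | up a₁ | zero t b₁ = ⊥-elim (01-vs-j0 a₀ a₁ b₀
    (trans b₁ (cong (0 ,_) (trans (sym (agree-as ag₁ a₁ b₁)) (not-involutive s)))) ag₂ ag₃)
  ... | zero t a₁ | zero t′ b₁ with refl ← agree-as ag₁ a₁ b₁ = trans a₁ (sym b₁)
  ... | zero t a₁ | up b₁ with refl ← agree-as ag₁ a₁ b₁ with next a₁ | next b₁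
  ...   | zero _ a₂ | _ with () ← clash a₀ (before-0-0 a₁ a₂)
  ...   | up a₂ | up b₂ = ⊥-elim (b≢not-b (sym (agree-as ag₂ a₂ b₂)))
  ...   | up a₂ | zero t b₂ = ⊥-elim (01-vs-j0 a₁ a₂ b₁
    (trans b₂ (cong (0 ,_) (trans (sym (agree-as ag₂ a₂ b₂)) (not-involutive s)))) ag₃ (ag₄ (letter≤ b₁)))

  -- The positions τ + a and τ + b carry different readings of the same binary letter;
  -- the numbers of both letters are at least τ + 1 unless they are 0.
  data Apart (a b τ : ℕ) : Set where
    inner : ∀ {l m s} → U (τ + a) ≡ (suc l , s) → U (τ + b) ≡ (suc m , s) → τ ≤ l → τ ≤ m → Apart a b τ
    zeroˡ : ∀ {j s} → U (τ + a) ≡ (0 , not s) → U (τ + b) ≡ (suc j , s) → τ ≤ j → Apart a b τ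
    zeroʳ : ∀ {j s} → U (τ + a) ≡ (suc j , s) → U (τ + b) ≡ (0 , not s) → τ ≤ j → Apart a b τ

  Synced : ℕ → ℕ → Set
  Synced a b = ∃ λ τ → τ ≤ suc κ × U (τ + a) ≡ U (τ + b)

  module _ {a b : ℕ} (agree : ∀ t → t < 4 + κ → Agree (t + a) (t + b)) where

    private
      at-most : ∀ {τ} n → τ ≤ κ → n < 4 → Agree (n + τ + a) (n + τ + b)
      at-most {τ} n τ≤κ n<4 = agree (n + τ) (+-mono-<-≤ n<4 τ≤κ)

      at-most-4 : ∀ {τ j} → τ ≤ j → j < κ → Agree (4 + τ + a) (4 + τ + b)
      at-most-4 τ≤j j<κ = agree _ (s≤s (s≤s (s≤s (s≤s (≤-<-trans τ≤j j<κ)))))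

      2<4 : 2 < 4
      2<4 = s≤s (s≤s (s≤s z≤n))

    -- Two nonzero letters climb together until one gives way to 0, at the latest after `k-1`; then
    -- `resync` applies. If both give way, equal bits make the zeros equal. The number `n` bounds
    -- the remaining steps.
    apart⇒synced : ∀ n {τ} → κ < n + τ → Apart a b τ → Synced a b
    apart⇒synced n {τ} _ (zeroˡ a₀ b₀ τ≤j) = suc τ , s≤s τ≤κ ,
      resync a₀ b₀ (at-most 1 τ≤κ (s≤s (s≤s z≤n))) (at-most 2 τ≤κ 2<4) (at-most 3 τ≤κ ≤-refl) (at-most-4 τ≤j)
      where τ≤κ = ≤-trans τ≤j (letter≤ b₀)
    apart⇒synced n {τ} _ (zeroʳ a₀ b₀ τ≤j) = suc τ , s≤s τ≤κ , sym
      (resync b₀ a₀ (sym (at-most 1 τ≤κ (s≤s (s≤s z≤n)))) (sym (at-most 2 τ≤κ 2<4)) (sym (at-most 3 τ≤κ ≤-refl))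
        (λ j<κ → sym (at-most-4 τ≤j j<κ)))
      where τ≤κ = ≤-trans τ≤j (letter≤ a₀)
    apart⇒synced zero κ< (inner a₀ b₀ τ≤l τ≤m) = contradiction (≤-trans τ≤l (letter≤ a₀)) (<⇒≱ κ<)
    apart⇒synced (suc n) {τ} κ< (inner {s = s} a₀ b₀ τ≤l τ≤m)
      with ag ← at-most 1 (≤-trans τ≤l (letter≤ a₀)) (s≤s (s≤s z≤n)) | next a₀ | next b₀
    ... | up a₁ | up b₁ = apart⇒synced n (subst (κ <_) (sym (+-suc n τ)) κ<) (inner a₁ b₁ (s≤s τ≤l) (s≤s τ≤m))
    ... | zero t a₁ | zero t′ b₁ with refl ← agree-as ag a₁ b₁ = suc τ , s≤s (≤-trans τ≤l (letter≤ a₀)) , trans a₁ (sym b₁)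
    ... | up a₁ | zero t b₁ with refl ← agree-as ag a₁ b₁ =
      apart⇒synced n (subst (κ <_) (sym (+-suc n τ)) κ<) (zeroʳ a₁ b₁ (s≤s τ≤l))
    ... | zero t a₁ | up b₁ with refl ← agree-as ag a₁ b₁ =
      apart⇒synced n (subst (κ <_) (sym (+-suc n τ)) κ<) (zeroˡ a₁ b₁ (s≤s τ≤m))

    synced : Synced a b
    synced with ag ← agree 0 z<s | U a in a₀ | U b in b₀
    ... | zero , s | zero , t with refl ← ag = 0 , z≤n , trans a₀ (sym b₀)
    ... | suc _ , s | suc _ , t with refl ← not-injective {s} {t} ag =
      apart⇒synced (suc κ) (m≤m+n (suc κ) 0) (inner a₀ b₀ z≤n z≤n)
    ... | zero , s | suc _ , t with refl ← ag = apart⇒synced (suc κ) (m≤m+n (suc κ) 0) (zeroˡ a₀ b₀ z≤n)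
    ... | suc _ , s | zero , t with refl ← ag = apart⇒synced (suc κ) (m≤m+n (suc κ) 0) (zeroʳ a₀ b₀ z≤n)

  -- Excluding long repetitions and long runs.

  data Split (a b j : ℕ) (s : Bool) : Set where
    together : U (suc a) ≡ U (suc b) → Split a b j s
    splitˡ : U (suc a) ≡ (suc j , s) → U (suc b) ≡ (0 , not s) → Split a b j s
    splitʳ : U (suc a) ≡ (0 , not s) → U (suc b) ≡ (suc j , s) → Split a b j s

  split : ∀ {a b j s} → U a ≡ (j , s) → U b ≡ (j , s) → Agree (suc a) (suc b) → Split a b j s
  split a₀ b₀ ag with next a₀ | next b₀
  ... | up a₁ | up b₁ = together (trans a₁ (sym b₁))
  ... | zero _ a₁ | zero _ b₁ with refl ← agree-as ag a₁ b₁ = together (trans a₁ (sym b₁))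
  ... | up a₁ | zero _ b₁ with refl ← agree-as ag a₁ b₁ = splitˡ a₁ b₁
  ... | zero _ a₁ | up b₁ with refl ← agree-as ag a₁ b₁ = splitʳ a₁ b₁

  -- The letter `j` before it and `j + 1` opposite force the 0 at `1 + b` to begin `012`. The bits
  -- then force two zeros after `1 + a`, the first of sign `s`, but such a pair is preceded by sign
  -- `not s`.
  split-short : ∀ {a b j s} → U b ≡ (j , s) → U (1 + a) ≡ (suc j , s) → U (1 + b) ≡ (0 , not s) →
    Agree (2 + a) (2 + b) → Agree (3 + a) (3 + b) → ⊥
  split-short {s = s} b₀ a₁ b₁ ag₂ ag₃ with next b₁
  ... | zero _ b₂ = contradiction
    (letter≤ (trans a₁ (cong (λ c → suc (proj₁ c) , s) (clash b₀ (before-0-0 b₁ b₂))))) (<⇒≱ (n<1+n κ))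
  ... | up b₂ with next b₂
  ...   | zero _ b₃ = sign-clash b₀ (before-01-0 b₁ b₂ b₃)
  ...   | up b₃ with next a₁
  ...     | up a₂ = b≢not-b (agree-as ag₂ a₂ b₂)
  ...     | zero t a₂ with refl ← trans (agree-as ag₂ a₂ b₂) (not-involutive s) with next a₂
  ...       | up a₃ = b≢not-b (agree-as ag₃ a₃ b₃)
  ...       | zero _ a₃ = sign-clash a₁ (before-0-0 a₂ a₃)

  follows-bit : ∀ {s a} → Follows s a → bit a ≡ not s
  follows-bit flipped    = refl
  follows-bit (letter _) = refl

  -- As `0 < h`, the windows have length at least `k + 2`, as `synced` requires. It uses up at most
  -- `k-1` positions, which leaves one period and one more letter.
  no-repetition : ∀ {i h} → 0 < h →
    (∀ t → t < suc h + (2 + κ) → Agree (t + i) (t + (i + suc h))) → ⊥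
  no-repetition {i} {h} 0<h agree
    with synced {i} {i + suc h} (λ t t< → agree t (<-≤-trans t< (+-monoˡ-≤ (2 + κ) (s≤s 0<h))))
  ... | τ , τ≤ , e = ends
    where
    a = τ + i
    b≡ : τ + (i + suc h) ≡ a + suc h
    b≡ = sym (+-assoc τ i (suc h))

    agree′ : ∀ t → t < suc h + 1 → Agree (t + a) (t + (a + suc h))
    agree′ t t< = subst₂ Agree (+-assoc t τ i) (trans (+-assoc t τ _) (cong (t +_) b≡))
      (agree (t + τ) (subst (t + τ <_) (+-assoc (suc h) 1 (suc κ)) (+-mono-<-≤ t< τ≤)))

    agree″ : ∀ t → suc t < h → Agree (2 + t + a) (2 + t + (a + suc h)) × Agree (3 + t + a) (3 + t + (a + suc h))
    agree″ t t< = agree′ (2 + t) (≤-trans (s≤s t<) (m≤m+n (suc h) 1))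
                , subst₂ Agree (+-assoc (3 + t) τ i) (trans (+-assoc (3 + t) τ _) (cong (3 + t +_) b≡))
                    (agree (3 + t + τ) (s≤s (subst (_≤ h + (2 + κ)) (+-suc (2 + t) τ) (+-mono-≤ t< (s≤s τ≤)))))

    matches : ∀ d → d ≤ h → Match a (a + suc h) (suc d)
    matches zero _ = match-right 0 (λ _ ())
      (trans (cong U (+-identityʳ a)) (trans e (cong U (trans b≡ (sym (+-identityʳ _))))))
    matches (suc d) d<h with M ← matches d (<⇒≤ d<h) | U (d + a) in e₀
    ... | j , s with e₁ ← trans (cong U (+-comm d (a + suc h))) (trans (sym (M d (n<1+n d))) (trans (cong U (+-comm a d)) e₀))
      with split e₀ e₁ (agree′ (suc d) (≤-trans (s≤s d<h) (m≤m+n (suc h) 1)))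
    ... | together e₂ = match-right (suc d) M (trans (cong U (+-comm a (suc d))) (trans e₂ (cong U (+-comm (suc d) (a + suc h)))))
    -- Before the last letter of the period there is room for `split-short`; at the last letter the
    -- split completes an almost square.
    ... | splitˡ e₂ e₃ with m≤n⇒m<n∨m≡n d<h
    ...   | inj₁ d< = ⊥-elim (split-short e₁ e₂ e₃ (proj₁ (agree″ d d<)) (proj₂ (agree″ d d<)))
    ...   | inj₂ refl = ⊥-elim (proj₂ (squares (suc (a + h)) a h (n<1+n _)) 0<h M
              (trans (cong U (+-comm a h)) (trans e₂ (cong (suc j ,_) (sym (not-involutive s)))))
              (trans (cong U (+-comm (a + suc h) h)) e₃))
    matches (suc d) d<h | j , s | splitʳ e₂ e₃ with m≤n⇒m<n∨m≡n d<h
    ...   | inj₁ d< = ⊥-elim (split-short e₀ e₃ e₂ (sym (proj₁ (agree″ d d<))) (sym (proj₂ (agree″ d d<))))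
    ...   | inj₂ refl = ⊥-elim (no-almost-square′ (λ {p′} _ → proj₁ (squares (suc (p′ + h)) p′ h (n<1+n _))) 0<h M
              (trans (cong U (+-comm a h)) e₂)
              (trans (cong U (+-comm (a + suc h) h)) (trans e₃ (cong (suc j ,_) (sym (not-involutive s))))))

    ends : ⊥
    ends with proj₁ (squares (suc (a + h)) a h (n<1+n _)) (matches h ≤-refl)
    ... | s , e₀ , F = b≢not-b (trans
      (agree-as (agree′ (suc h) (≤-reflexive (+-comm 1 (suc h))))
        (trans (cong U (+-comm (suc h) a)) (trans (sym (match-head z<s (matches h ≤-refl))) e₀))
        (cong U (+-comm (suc h) (a + suc h))))
      (follows-bit F))

  no-long-zero-run : ∀ {q s} → U q ≡ (0 , s) → Agree q (1 + q) → Agree (1 + q) (2 + q) → ⊥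
  no-long-zero-run {s = s} q₀ ag₁ ag₂ with next q₀
  ... | up q₁ = b≢not-b (agree-as ag₁ q₀ q₁)
  ... | zero t q₁ with refl ← agree-as ag₁ q₀ q₁ with next q₁
  ...   | up q₂ = b≢not-b (agree-as ag₂ q₁ q₂)
  ...   | zero _ q₂ with () ← clash q₀ (before-0-0 q₁ q₂)

  -- A run has at most `k-1` climbing letters followed by at most two zeros.
  no-long-run : ∀ {i} → (∀ t → t < 3 + κ → Agree (t + i) (suc t + i)) → ⊥
  no-long-run {i} agree with U i in e
  ... | zero , s  = no-long-zero-run e (agree 0 z<s) (agree 1 (s≤s (s≤s z≤n)))
  ... | suc l , s = climb (suc κ) (m≤m+n (suc κ) 0) e z≤n
    where
    climb : ∀ n {τ l s} → κ < n + τ → U (τ + i) ≡ (suc l , s) → τ ≤ l → ⊥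
    climb zero κ< eq τ≤l = contradiction (≤-trans τ≤l (letter≤ eq)) (<⇒≱ κ<)
    climb (suc n) {τ} κ< eq τ≤l with τ≤κ ← ≤-trans τ≤l (letter≤ eq) | next eq
    ... | up eq′     = climb n (subst (κ <_) (sym (+-suc n τ)) κ<) eq′ (s≤s τ≤l)
    ... | zero t eq′ = no-long-zero-run eq′ (agree (1 + τ) (s≤s (≤-trans (s≤s τ≤κ) (n≤1+n _)))) (agree (2 + τ) (s≤s (s≤s (s≤s τ≤κ))))

  -- Long runs and long squares

  Block : ℕ → Bool → ℕ → Set
  Block j s p = ∀ t → t ≤ j → U (t + p) ≡ (t , s)

  block-φ : ∀ {j s p} → Block j s p → ∀ t → t ≤ j → φ (suc t + p) ≡ suc (suc t) + φ p
  block-φ {p = p} B zero _ = trans (φ-suc p) (trans (cong (λ a → φ p + size a) (B 0 z≤n)) (+-comm (φ p) 2))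
  block-φ {p = p} B (suc t) t< = trans (φ-suc (suc t + p))
    (trans (cong₂ (λ q a → q + size a) (block-φ B t (<⇒≤ t<)) (B (suc t) t<)) (+-comm (suc (suc t) + φ p) 1))

  block-image : ∀ {j s p} → j ≤ κ → Block j s p → Block (suc j) s (φ p)
  block-image {s = s} {p} j≤κ B t t≤ = go t t≤
    where
    go : ∀ t → t ≤ _ → U (t + φ p) ≡ (t , s)
    go zero _ with image p
    ... | double _ e _ e′ _ with refl ← clash e (B 0 z≤n) = e′
    ... | raise _ _ e _ _ _ with () ← clash e (B 0 z≤n)
    ... | wrap _ e _ _ with () ← clash e (B 0 z≤n)
    go (suc zero) _ with image p
    ... | double _ e _ _ e′ with refl ← clash e (B 0 z≤n) = e′
    ... | raise _ _ e _ _ _ with () ← clash e (B 0 z≤n)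
    ... | wrap _ e _ _ with () ← clash e (B 0 z≤n)
    go (suc (suc t)) (s≤s t<) with image (suc t + p)
    ... | double _ e _ _ _ with () ← clash e (B (suc t) t<)
    ... | raise _ _ e _ _ e′ with refl ← clash e (B (suc t) t<) = trans (cong U (sym (block-φ B t (<⇒≤ t<)))) e′
    ... | wrap _ e _ _ with refl ← clash e (B (suc t) t<) = contradiction (≤-trans t< j≤κ) (<⇒≱ (n<1+n κ))

  blocks : ∀ {s p} → U p ≡ (0 , s) → ∀ j → j ≤ suc κ → ∃ (Block j s)
  blocks {p = p} e zero _ = p , λ { zero _ → e }
  blocks e (suc j) (s≤s j≤κ) with blocks e j (≤-trans j≤κ (n≤1+n κ))
  ... | p , B = φ p , block-image j≤κ B

  LongBlock : Bool → ℕ → Set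
  LongBlock = Block (suc κ)

  long-block-image : ∀ {s p} → LongBlock s p → LongBlock s (φ p) × U (2 + κ + φ p) ≡ (0 , not s)
  long-block-image {s} {p} B = block-image ≤-refl (λ t t≤ → B t (≤-trans t≤ (n≤1+n κ))) , wrapped
    where
    wrapped : U (2 + κ + φ p) ≡ (0 , not s)
    wrapped with image (suc κ + p)
    ... | double _ e _ _ _ with () ← clash e (B (suc κ) ≤-refl)
    ... | raise _ _ e j< _ _ with refl ← clash e (B (suc κ) ≤-refl) = contradiction j< (<-irrefl refl)
    ... | wrap _ e _ e′ with refl ← clash e (B (suc κ) ≤-refl) = trans (cong U (sym (block-φ B κ (n≤1+n κ)))) e′

  -- Applied to `01…(k-1)`, `ξ` appends a 0 of opposite sign; applied again, it appends such a 0 and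
  -- the image of the former one, which starts with 0.
  long-run-block : ∀ {s p} → U p ≡ (0 , s) →
    ∃ λ q → LongBlock s q × U (2 + κ + q) ≡ (0 , not s) × U (3 + κ + q) ≡ (0 , not s)
  long-run-block e with blocks e (suc κ) ≤-refl
  ... | p , B with long-block-image B
  ...   | B′ , e′ with long-block-image B′
  ...     | B″ , e″ = φ (φ p) , B″ , e″ , trans (cong U (sym (block-φ B′ (suc κ) ≤-refl))) (zero-image e′)

  zero-letter : ∀ s → ∃ λ p → U p ≡ (0 , s)
  zero-letter false = 0 , U-zero
  zero-letter true with long-run-block U-zero
  ... | q , _ , e , _ = 2 + κ + q , e

  constant-run : ∀ s → ∃ λ i → ∀ t → t < 3 + κ → bit (U (i + t)) ≡ not s
  constant-run s with zero-letter s
  ... | p , e with long-run-block e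
  -- Without its initial 0, the block and the two zeros after it give `k + 1` letters of equal bit.
  ...   | q , B , e₁ , e₂ = suc q , λ t t< → trans (cong (λ r → bit (U r)) (+-comm (suc q) t)) (go t t<)
    where
    go : ∀ t → t < 3 + κ → bit (U (t + suc q)) ≡ not s
    go t (s≤s t≤) with m≤n⇒m<n∨m≡n t≤
    ... | inj₂ refl = cong bit (trans (cong U (+-suc (2 + κ) q)) e₂)
    ... | inj₁ (s≤s t≤′) with m≤n⇒m<n∨m≡n t≤′
    ...   | inj₂ refl = cong bit (trans (cong U (+-suc (suc κ) q)) e₁)
    ...   | inj₁ t< = cong bit (trans (cong U (+-suc t q)) (B (suc t) t<))

  φ-+-≥ : ∀ a m → φ a + m ≤ φ (a + m)
  φ-+-≥ a zero    = ≤-reflexive (trans (+-identityʳ _) (cong φ (sym (+-identityʳ a))))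
  φ-+-≥ a (suc m) = ≤-trans (≤-reflexive (+-suc (φ a) m)) (≤-<-trans (φ-+-≥ a m) (φ-+-> a m))

  substitute : ∀ {a b} m → Match a b m →
    ∃ λ d → φ (a + m) ≡ φ a + d × φ (b + m) ≡ φ b + d × Match (φ a) (φ b) d
  substitute {a} {b} zero M = 0 , trans (cong φ (+-identityʳ a)) (sym (+-identityʳ _))
                            , trans (cong φ (+-identityʳ b)) (sym (+-identityʳ _)) , λ _ ()
  substitute {a} {b} (suc m) M with substitute m (match-≤ (n≤1+n m) M)
  ... | d , φa , φb , M′ = d + size (U (a + m))
      , trans (φ-+ {a} {m} φa) (+-assoc (φ a) d _)
      , trans (φ-+ {b} {m} φb) (trans (+-assoc (φ b) d _) (cong (λ c → φ b + (d + size c)) (sym (M m (n<1+n m)))))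
      , M″
    where
    M₀ : U (φ (a + m)) ≡ U (φ (b + m)) → Match (φ a) (φ b) (suc d)
    M₀ e = match-right d M′ (trans (cong U (sym φa)) (trans e (cong U φb)))
    M″ : Match (φ a) (φ b) (d + size (U (a + m)))
    M″ with image (a + m) | image (b + m) | M m (n<1+n m)
    ... | double _ e₀ _ e₁ e₂ | double _ f₀ _ f₁ f₂ | e
      with refl ← trans (sym e₀) (trans e f₀) = subst (Match (φ a) (φ b))
        (trans (+-comm 2 d) (cong (λ c → d + size c) (sym e₀)))
        (match-right (suc d) (M₀ (trans e₁ (sym f₁)))
          (trans (cong U (trans (+-suc (φ a) d) (cong suc (sym φa)))) (trans e₂ (trans (sym f₂)
            (cong U (trans (cong suc φb) (sym (+-suc (φ b) d))))))))
    ... | raise _ _ e₀ _ _ e₁ | raise _ _ f₀ _ _ f₁ | e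
      with refl ← trans (sym e₀) (trans e f₀) = subst (Match (φ a) (φ b))
        (trans (+-comm 1 d) (cong (λ c → d + size c) (sym e₀))) (M₀ (trans e₁ (sym f₁)))
    ... | wrap _ e₀ _ e₁ | wrap _ f₀ _ f₁ | e
      with refl ← trans (sym e₀) (trans e f₀) = subst (Match (φ a) (φ b))
        (trans (+-comm 1 d) (cong (λ c → d + size c) (sym e₀))) (M₀ (trans e₁ (sym f₁)))
    ... | double _ e₀ _ _ _ | raise _ _ f₀ _ _ _ | e with () ← trans (sym e₀) (trans e f₀)
    ... | double _ e₀ _ _ _ | wrap _ f₀ _ _ | e with () ← trans (sym e₀) (trans e f₀)
    ... | raise _ _ e₀ _ _ _ | double _ f₀ _ _ _ | e with () ← trans (sym e₀) (trans e f₀)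
    ... | wrap _ e₀ _ _ | double _ f₀ _ _ _ | e with () ← trans (sym e₀) (trans e f₀)
    ... | raise _ _ e₀ j< _ _ | wrap _ f₀ _ _ | e with refl ← trans (sym e₀) (trans e f₀) = contradiction j< (<-irrefl refl)
    ... | wrap _ e₀ _ _ | raise _ _ f₀ j< _ _ | e with refl ← trans (sym e₀) (trans e f₀) = contradiction j< (<-irrefl refl)

  -- The images of `00` under powers of `ξ`. The initial 0 is kept as an invariant because it makes
  -- the period grow strictly.
  long-squares : ∀ N → ∃₂ λ p n → N < n × (∃ λ s → U p ≡ (0 , s)) × Match p (p + n) n
  long-squares zero with long-run-block U-zero
  ... | q , _ , e₁ , e₂ = 2 + κ + q , 1 , z<s , (true , e₁) , match-right 0 (λ _ ())
    (trans (cong U (+-identityʳ _)) (trans e₁ (trans (sym e₂) (cong U (sym (trans (+-identityʳ _) (+-comm (2 + κ + q) 1)))))))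
  long-squares (suc N) with long-squares N
  ... | p , suc n , N<n , (s , e) , M with substitute (suc n) M
  ...   | d , φ₁ , φ₂ , M′ = φ p , d , <-≤-trans (s≤s N<n) d> , (s , zero-image e)
        , subst (λ q → Match (φ p) q d) φ₁ M′
    where
    d> : suc (suc n) ≤ d
    d> = +-cancelˡ-≤ (φ p) _ _ (≤-trans (≤-reflexive (trans (+-suc (φ p) (suc n)) (trans (cong suc (+-suc (φ p) n)) (sym (cong (_+ n) (trans (φ-suc p) (trans (cong (λ a → φ p + size a) e) (+-comm (φ p) 2))))))))
      (≤-trans (φ-+-≥ (suc p) n) (≤-reflexive (trans (cong φ (sym (+-suc p n))) φ₁))))

-- The exponents of `x`.

bit⇒π : ∀ a → (bit a ≡ false → π a ≡ 0) × (bit a ≡ true → π a ≡ 1)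
bit⇒π (zero  , false) = (λ _ → refl) , λ ()
bit⇒π (zero  , true)  = (λ ()) , λ _ → refl
bit⇒π (suc _ , false) = (λ ()) , λ _ → refl
bit⇒π (suc _ , true)  = (λ _ → refl) , λ ()

module Exponent (κ : ℕ) (2≤κ : 2 ≤ κ) where

  open Images κ
  open Iterates k using (φ)
  open FixedPoint κ 2≤κ (u k) φ refl refl image

  periodic⇒agree : ∀ i {p q} → PeriodicFactor (x k) i p q →
    ∀ t → t + q < p → Agree (t + i) (t + (i + q))
  periodic⇒agree i {p} {q} (_ , periodic) t t< = subst₂ Agree (+-comm i t) shift (π-bit _ _ (periodic t t<))
    where
    shift : i + t + q ≡ t + (i + q)
    shift = trans (cong (_+ q) (+-comm i t)) (+-assoc t i q)

  no-2n+k : ∀ n → 1 ≤ n → ¬ (∃ λ i → PeriodicFactor (x k) i (2 * n + k) n)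
  -- Period 1 gives windows of length `k + 1`, too short for `synced`, so runs are treated directly.
  no-2n+k (suc zero) _ (i , periodic) = no-long-run λ t t< →
    subst (Agree (t + i)) (trans (cong (t +_) (+-comm i 1)) (+-suc t i))
      (periodic⇒agree i periodic t (subst (_< 2 + k) (+-comm 1 t) (s≤s t<)))
  no-2n+k n@(suc (suc h)) _ (i , periodic) = no-repetition z<s λ t t< →
    periodic⇒agree i periodic t (<-≤-trans (+-monoˡ-< n t<) (≤-reflexive (rearrange n k)))
    where
    rearrange : ∀ n k → n + k + n ≡ 2 * n + k
    rearrange = solve-∀

  length<2q+k : ∀ i {p q} → PeriodicFactor (x k) i p q → p < 2 * q + k
  length<2q+k i {p} {q} (1≤q , periodic) with 2 * q + k ≤? p
  ... | no ≰p = ≰⇒> ≰p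
  ... | yes ≤p = ⊥-elim (no-2n+k q 1≤q (i , 1≤q , λ t t< → periodic t (<-≤-trans t< ≤p)))

  run : ∀ c s → (∀ a → bit a ≡ not s → π a ≡ c) → HasConstFactor (x k) c (k + 1)
  run c s value with constant-run s
  ... | i , const = i , λ t t< → value _ (const t (subst (t <_) (+-comm k 1) t<))

  zeros : HasConstFactor (x k) 0 (k + 1)
  zeros = run 0 true (λ a → proj₁ (bit⇒π a))

  ones : HasConstFactor (x k) 1 (k + 1)
  ones = run 1 false (λ a → proj₂ (bit⇒π a))

  -- The bound `2q + k - 1` is at most `(k + 1) q` for `q ≥ 1`, with equality at `q = 1`, where the
  -- run of ones attains it.
  critical-exponent : CriticalExponentIsAttained (x k) (k + 1)
  critical-exponent = bound , i , k + 1 , 1 , s≤s z≤n , (≤-refl , periodic) , sym (*-identityʳ (k + 1))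
    where
    bound : ∀ i p q → 1 ≤ p → PeriodicFactor (x k) i p q → p ≤ (k + 1) * q
    bound i p (suc q) _ periodic = ≤-trans (s≤s⁻¹ (≤-trans (length<2q+k i periodic) (≤-reflexive (expand q κ))))
      (≤-trans (+-monoʳ-≤ (3 + κ) (m≤m+n (2 * q) ((1 + κ) * q))) (≤-reflexive (collect q κ)))
      where
      expand : ∀ q κ → 2 * suc q + suc (suc κ) ≡ suc (3 + κ + 2 * q)
      expand = solve-∀
      collect : ∀ q κ → 3 + κ + (2 * q + (1 + κ) * q) ≡ (suc (suc κ) + 1) * suc q
      collect = solve-∀
    bound i p zero _ (() , _)
    i = proj₁ ones
    periodic : ∀ t → t + 1 < k + 1 → x k (i + t) ≡ x k (i + t + 1)
    periodic t t< = trans (proj₂ ones t (<-trans (m<m+n t z<s) t<))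
      (trans (sym (proj₂ ones (t + 1) t<)) (cong (x k) (sym (+-assoc i t 1))))

  asymptotic-exponent : AsymptoticCriticalExponentIs (x k) 2
  -- For `q ≥ m * k` the excess `k` over a square is at most `q / m`.
  asymptotic-exponent m 1≤m = m * k , λ n N≤n →
      (λ i p q _ n≤q periodic → upper p q (≤-trans N≤n n≤q) (<⇒≤ (length<2q+k i periodic)))
    , lower n
    where
    upper : ∀ p q → m * k ≤ q → p ≤ 2 * q + k → m * p ≤ (2 * m + 1) * q
    upper p q N≤q p≤ = begin
      m * p                 ≤⟨ *-monoʳ-≤ m p≤ ⟩
      m * (2 * q + k)       ≡⟨ distribute m q k ⟩
      2 * m * q + m * k     ≤⟨ +-monoʳ-≤ (2 * m * q) N≤q ⟩
      2 * m * q + q         ≡⟨ collect m q ⟩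
      (2 * m + 1) * q       ∎
      where
      open ≤-Reasoning
      distribute : ∀ m q k → m * (2 * q + k) ≡ 2 * m * q + m * k
      distribute = solve-∀
      collect : ∀ m q → 2 * m * q + q ≡ (2 * m + 1) * q
      collect = solve-∀
    lower : ∀ n → ∃ λ i → ∃ λ p → ∃ λ q →
      1 ≤ p × n ≤ q × PeriodicFactor (x k) i p q × (2 * m) * q < m * p + q
    lower n with long-squares n
    ... | i , q , n<q , _ , M = i , 2 * q , q , ≤-trans 1≤q (m≤m+n q _) , <⇒≤ n<q , (1≤q , periodic)
        , subst (λ r → 2 * m * q < r + q) (commute m q) (m<m+n (2 * m * q) 1≤q)
      where
      1≤q : 1 ≤ q
      1≤q = ≤-trans (s≤s z≤n) n<q
      commute : ∀ m q → 2 * m * q ≡ m * (2 * q)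
      commute = solve-∀
      swap : ∀ i t q → i + q + t ≡ i + t + q
      swap = solve-∀
      periodic : ∀ t → t + q < 2 * q → x k (i + t) ≡ x k (i + t + q)
      periodic t t< = trans
        (cong π (M t (+-cancelʳ-< q t q (subst (t + q <_) (cong (q +_) (+-identityʳ q)) t<))))
        (cong (x k) (swap i t q))

theorem4 : ∀ k → 4 ≤ k →
    CriticalExponentIsAttained (x k) (k + 1)
    × HasConstFactor (x k) 0 (k + 1)
    × HasConstFactor (x k) 1 (k + 1)
    × (∀ n → 1 ≤ n → ¬ (∃ λ i → PeriodicFactor (x k) i (2 * n + k) n))
    × AsymptoticCriticalExponentIs (x k) 2
theorem4 (suc (suc κ)) (s≤s (s≤s 2≤κ)) = critical-exponent , zeros , ones , no-2n+k , asymptotic-exponent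
  where open Exponent κ 2≤κ
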